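{- If $M$ and $M'$ are noncrossing matchings on $\langle 0,2n-1\rangle$, then $$d_{ncm}(M,M')=d_{mat}(M,M')=n-\pi_0(M,M').$$
   Context: $\langle 0,2n-1\rangle=\{0,1,\ldots,2n-1\}$, $n\ge1$. A matching on this set is a partition of it into $n$ subsets of size $2$ (pairs); it is noncrossing if there are no $i<j<k<\ell$ with $\{i,k\}$ and $\{j,\ell\}$ both pairs. $M'$ is a flip of $M$ if $M'$ is obtained from $M$ by replacing two pairs $\{i,j\},\{k,\ell\}$ of $M$ by $\{i,\ell\},\{j,k\}$. $G_{mat}$ is the graph whose vertices are all matchings on $\langle 0,2n-1\rangle$ and whose edges are the pairs $(M,M')$ such that $M'$ is a flip of $M$; $G_{ncm}$ is the graph whose vertices are the noncrossing matchings on $\langle 0,2n-1\rangle$, with edges again the pairs related by a flip. $d_{mat}$ and $d_{ncm}$ are the graph distance functions on $G_{mat}$ and $G_{ncm}$. For matchings $M,M'$, $\pi_0(M,M')$ is the number of equivalence classes of the equivalence relation on $\langle 0,2n-1\rangle$ generated by $i\sim j$ for every $\{i,j\}\in M$ and for every $\{i,j\}\in M'$. -}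

module Defs where

open import Data.Fin.Base using (Fin; _<_)
open import Data.Fin.Properties using (injective⇒≤)
open import Data.Nat.Base using (ℕ; suc; _*_; _≤_)
open import Data.Nat.Properties using (≤-antisym)
open import Data.Product using (Σ; ∃!; ∃-syntax; _×_; _,_; proj₁; swap)
open import Data.Sum.Base using (_⊎_)
open import Function.Base using (_on_)
open import Function.Bundles using (_⇔_; Bijection; Inverse)
open import Function.Properties.Bijection using (Bijection⇒Inverse)
open import Level using (0ℓ)
open import Relation.Binary.Bundles using (Setoid)
open import Relation.Binary.Construct.Closure.Equivalence as EqC using ()
open import Relation.Binary.Construct.Union using (_∪_)
open import Relation.Binary.Core using (Rel)
open import Relation.Binary.Definitions using (Irreflexive; Symmetric)
open import Relation.Binary.PropositionalEquality
  using (_≡_; sym; trans; setoid)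
open import Relation.Nullary.Negation using (¬_)

-- A set of two-element subsets {i , j} is given by its membership relation,
-- which is symmetric and irreflexive; it is a partition when every i lies in
-- exactly one of the subsets.  On 2 * n points there are then n subsets.

record Matching (n : ℕ) : Set₁ where
  field
    Pair     : Rel (Fin (2 * n)) 0ℓ
    pair-irr : Irreflexive _≡_ Pair
    pair-sym : Symmetric Pair
    covered  : ∀ i → ∃! _≡_ (Pair i)

open Matching public

private
  variable
    n : ℕ

-- Equality as sets of pairs.

infix 4 _≋_

_≋_ : Rel (Matching n) 0ℓ
M ≋ M′ = ∀ i j → Pair M i j ⇔ Pair M′ i j

NonCrossing : Matching n → Set
NonCrossing M =
  ¬ (∃[ i ] ∃[ j ] ∃[ k ] ∃[ l ]
       i < j × j < k × k < l × Pair M i k × Pair M j l)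

-- (i , j) ≐ (k , l) says that {i , j} = {k , l}.

infix 4 _≐_

_≐_ : {A : Set} → Rel (A × A) 0ℓ
p ≐ q = p ≡ q ⊎ p ≡ swap q

-- M′ = (M ∖ { {i,j} , {k,l} }) ∪ { {i,l} , {j,k} }, where {i,j} and {k,l}
-- are two different pairs of M.

Flip : Rel (Matching n) 0ℓ
Flip M M′ = ∃[ i ] ∃[ j ] ∃[ k ] ∃[ l ]
  Pair M i j × Pair M k l × ¬ ((i , j) ≐ (k , l)) ×
  (∀ a b → Pair M′ a b ⇔
    ( (Pair M a b × ¬ ((a , b) ≐ (i , j)) × ¬ ((a , b) ≐ (k , l)))
    ⊎ ((a , b) ≐ (i , l))
    ⊎ ((a , b) ≐ (j , k)) ))

record Graph : Set₂ where
  field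
    Vertex : Set₁
    _≈_    : Rel Vertex 0ℓ
    Edge   : Rel Vertex 0ℓ

Gmat : ℕ → Graph
Gmat n = record { Vertex = Matching n ; _≈_ = _≋_ ; Edge = Flip }

Gncm : ℕ → Graph
Gncm n = record
  { Vertex = Σ (Matching n) NonCrossing
  ; _≈_    = _≋_ on proj₁
  ; Edge   = Flip on proj₁
  }

module _ (G : Graph) where
  open Graph G

  data Walk : ℕ → Vertex → Vertex → Set₁ where
    stop : ∀ {x y} → x ≈ y → Walk 0 x y
    step : ∀ {k x y z} → Edge x y → Walk k y z → Walk (suc k) x z

  -- The graph distance between x and y is (finite and equal to) d.

  IsDistance : Vertex → Vertex → ℕ → Set₁
  IsDistance x y d = Walk d x y × (∀ k → Walk k x y → d ≤ k)

  IsDistance-unique : ∀ {x y d e} →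
                      IsDistance x y d → IsDistance x y e → d ≡ e
  IsDistance-unique (w , w-min) (v , v-min) =
    ≤-antisym (w-min _ v) (v-min _ w)

HasCardinality : Setoid 0ℓ 0ℓ → ℕ → Set
HasCardinality S p = Bijection S (setoid (Fin p))

private
  HasCardinality-≤ : ∀ {S p q} → HasCardinality S p → HasCardinality S q → p ≤ q
  HasCardinality-≤ {S} β γ = injective⇒≤ {f = λ x → G.to (F.from x)} λ eq →
    trans (sym (F.strictlyInverseˡ _))
      (trans (F.to-cong (Bijection.injective γ eq)) (F.strictlyInverseˡ _))
    where
    module F = Inverse (Bijection⇒Inverse β)
    module G = Bijection γ

HasCardinality-unique : ∀ {S p q} →
                        HasCardinality S p → HasCardinality S q → p ≡ q
HasCardinality-unique β γ =
  ≤-antisym (HasCardinality-≤ β γ) (HasCardinality-≤ γ β)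

-- The points, with i and j identified when they are related by the equivalence
-- relation generated by the pairs of M and M′; the cardinality of this setoid
-- is the number of equivalence classes, π₀(M , M′).

Components : (M M′ : Matching n) → Setoid 0ℓ 0ℓ
Components M M′ = EqC.setoid (Pair M ∪ Pair M′)

Isπ₀ : (M M′ : Matching n) → ℕ → Set
Isπ₀ M M′ = HasCardinality (Components M M′)

{-# OPTIONS --safe #-}
module Submission where

-- Lower bound: a flip changes the number of components by at most one, and
-- π₀(M′, M′) = n.  Upper bound: if M ≠ M′, take a pair {i , j} of M′ outside M
-- such that every pair of M′ inside it already belongs to M.  If {i , a} and
-- {j , b} are the pairs of M at i and j, the flip replacing them by {i , j} and
-- {a , b} is again noncrossing, and it splits {i , j} off as a new component.

open import Defs
open import Data.Integer.Base using (+_; _-_)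
open import Data.Nat.Base using (ℕ; _≥_)
open import Data.Product.Base using (_×_; _,_; ∃-syntax)
open import Relation.Binary.PropositionalEquality using (_≡_)

open import Data.Fin.Base using (Fin; zero; suc; fromℕ<; punchIn; punchOut; _<_)
import Data.Fin.Permutation as Perm
open import Data.Fin.Permutation using (Permutation′; _⟨$⟩ʳ_; _⟨$⟩ˡ_; ↔⇒≡)
open import Data.Fin.Properties as Fin
  using (_≟_; _<?_; any?; *↔×; injective⇒≤; toℕ-inject; toℕ-fromℕ<; toℕ-injective;
         ¬∀⟶∃¬-smallest; punchInᵢ≢i; punchOut-injective; punchOut-punchIn; punchOut-cong)
import Data.Integer.Properties as ℤ
open import Data.List.Base using (List; []; _∷_; filter; allFin; cartesianProduct)
open import Data.List.Membership.Propositional using (_∈_)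
open import Data.List.Membership.Propositional.Properties
  using (∈-filter⁺; ∈-filter⁻; ∈-cartesianProduct⁺; ∈-allFin)
open import Data.List.Relation.Unary.Any using (here; there)
open import Data.Nat.Base as ℕ using (zero; suc; _+_; _∸_; _*_; _≤_; s≤s)
import Data.Nat.Properties as ℕ
open import Data.Product.Base using (Σ; ∃; proj₁; proj₂)
import Data.Product.Properties as Product
open import Data.Sum.Base using (_⊎_; inj₁; inj₂; [_,_]′)
open import Function.Base using (_∘_; _∘′_; id)
open import Function.Bundles using (Bijection; Equivalence; _⇔_; mk⤖; mk⇔)
open import Function.Consequences.Propositional using (strictlySurjective⇒surjective)
open import Function.Construct.Composition using (_↔-∘_)
open import Function.Properties.Bijection using (⤖⇒↔)
open import Function.Properties.Equivalence using (⇔-isEquivalence)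
open import Level using (0ℓ)
open import Relation.Binary.Core using (Rel; _⇒_)
open import Relation.Binary.Construct.Closure.Equivalence as EqC using (EqClosure)
open import Relation.Binary.Construct.Closure.ReflexiveTransitive using (ε; _◅◅_)
open import Relation.Binary.Construct.Union using (_∪_)
open import Relation.Binary.Definitions using (Decidable; tri<; tri≈; tri>)
open import Relation.Binary.PropositionalEquality
  using (_≢_; refl; sym; trans; cong; subst; isEquivalence; ≢-sym)
open import Relation.Binary.Structures using (IsEquivalence)
open import Relation.Nullary using (¬_; ¬?; Dec; yes; no; contradiction)
open import Relation.Nullary.Decidable using (map′; _⊎-dec_; _×-dec_; decidable-stable; dec-true; dec-false)
import Relation.Unary as U

-- Counting the classes of a generated equivalence relation

module _ {A : Set} where

  Card : Rel A 0ℓ → ℕ → Set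
  Card R = HasCardinality (EqC.setoid R)

  Edge : A → A → Rel A 0ℓ
  Edge a b x y = (x , y) ≡ (a , b)

  private
    variable
      R S : Rel A 0ℓ
      p q : ℕ
      a b : A

  card-from-labelling : (c : A → Fin p) →
    (∀ {x y} → R x y → c x ≡ c y) →
    (∀ {x y} → c x ≡ c y → EqClosure R x y) →
    (∀ k → ∃[ x ] c x ≡ k) → Card R p
  card-from-labelling c c-resp c-reflects c-onto = record
    { to        = c
    ; cong      = c-cong
    ; bijective = c-reflects ,
        λ k → let x , cx≡k = c-onto k in x , λ z∼x → trans (c-cong z∼x) cx≡k
    }
    where c-cong = EqC.gfold isEquivalence c c-resp

  card-cong : R ⇒ EqClosure S → S ⇒ EqClosure R → Card R p → Card S p
  card-cong R⇒S S⇒R β = card-from-labelling to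
    (cong′ ∘′ S⇒R)
    ((R⇒S EqC.⋆) ∘′ injective)
    strictlySurjective
    where open Bijection β renaming (cong to cong′)

  -- Each class of `S` is sent to the class of `R` containing a chosen representative. Two
  -- representatives related by `R` are related by `S`, so this map is injective.
  card-mono : R ⇒ EqClosure S → Card R p → Card S q → q ≤ p
  card-mono R⇒S β γ = injective⇒≤ {f = λ k → R.to (rep k)} λ {k} {l} eq →
    trans (sym (proj₂ (S.strictlySurjective k)))
      (trans (S.cong ((R⇒S EqC.⋆) (R.injective eq))) (proj₂ (S.strictlySurjective l)))
    where
    module R = Bijection β
    module S = Bijection γ
    rep = λ k → proj₁ (S.strictlySurjective k)

  -- A count carries a labelling of the classes by `Fin p`, and labels can be compared.
  related? : Card R p → Decidable (EqClosure R)
  related? β x y = map′ injective cong′ (to x ≟ to y)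
    where open Bijection β renaming (cong to cong′)

  -- The class of `b` takes over the label of `a`, and the freed label of `b` is removed from
  -- `Fin (suc q)` by `punchOut`.
  card-merge-unrelated : Card R p → ¬ EqClosure R a b →
                         ∃[ q ] p ≡ suc q × Card (R ∪ Edge a b) q
  card-merge-unrelated {p = zero} {a = a} β _ with () ← Bijection.to β a
  card-merge-unrelated {R} {p = suc q} {a} {b} β a≁b =
    q , refl , card-from-labelling (merge ∘ to) merge-resp merge-reflects merge-onto
    where
    open Bijection β renaming (cong to cong′)

    b≢a : to b ≢ to a
    b≢a eq = a≁b (injective (sym eq))

    merge : Fin (suc q) → Fin q
    merge k with to b ≟ k
    ... | yes _   = punchOut b≢a
    ... | no b≢k = punchOut b≢k

    merge-b : merge (to b) ≡ punchOut b≢a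
    merge-b with to b ≟ to b
    ... | yes _   = refl
    ... | no b≢b = contradiction refl b≢b

    merge-≢b : ∀ {k} (b≢k : to b ≢ k) → merge k ≡ punchOut b≢k
    merge-≢b {k} b≢k with to b ≟ k
    ... | yes b≡k = contradiction b≡k b≢k
    ... | no _    = punchOut-cong (to b) refl

    merge-resp : ∀ {x y} → (R ∪ Edge a b) x y → merge (to x) ≡ merge (to y)
    merge-resp (inj₁ r)    = cong merge (cong′ (EqC.return r))
    merge-resp (inj₂ refl) = trans (merge-≢b b≢a) (sym merge-b)

    lift : ∀ {x y} → to x ≡ to y → EqClosure (R ∪ Edge a b) x y
    lift eq = EqC.map inj₁ (injective eq)

    a∼b : EqClosure (R ∪ Edge a b) a b
    a∼b = EqC.return (inj₂ refl)

    merge-reflects : ∀ {x y} → merge (to x) ≡ merge (to y) →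
                     EqClosure (R ∪ Edge a b) x y
    merge-reflects {x} {y} eq with to b ≟ to x | to b ≟ to y
    ... | yes b≡x | yes b≡y = lift (trans (sym b≡x) b≡y)
    ... | yes b≡x | no b≢y  =
      lift (sym b≡x) ◅◅ EqC.symmetric _ a∼b ◅◅ lift (punchOut-injective b≢a b≢y eq)
    ... | no b≢x  | yes b≡y =
      lift (punchOut-injective b≢x b≢a eq) ◅◅ a∼b ◅◅ lift b≡y
    ... | no b≢x  | no b≢y  = lift (punchOut-injective b≢x b≢y eq)

    merge-onto : ∀ k → ∃[ x ] merge (to x) ≡ k
    merge-onto k with strictlySurjective (punchIn (to b) k)
    ... | x , x≡k′ = x , trans (cong merge x≡k′)
      (trans (merge-≢b (≢-sym (punchInᵢ≢i (to b) k))) (punchOut-punchIn (to b)))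

  card-merge : Card R p → ∀ a b → ∃[ q ] Card (R ∪ Edge a b) q × p ≤ suc q
  card-merge {p = p} β a b with related? β a b
  ... | yes a∼b = p
                , card-cong (EqC.return ∘′ inj₁)
                    (λ { (inj₁ r) → EqC.return r ; (inj₂ refl) → a∼b }) β
                , ℕ.n≤1+n p
  ... | no a≁b with q , p≡1+q , γ ← card-merge-unrelated β a≁b =
    q , γ , ℕ.≤-reflexive p≡1+q

module _ {N : ℕ} where

  -- The edges are added one at a time to the discrete relation, which has `N` singleton classes.
  card-list : (es : List (Fin N × Fin N)) → ∃[ p ] Card (λ x y → (x , y) ∈ es) p
  card-list []             =
    N , card-from-labelling id (λ ()) (λ { refl → ε }) (λ k → k , refl)
  card-list ((a , b) ∷ es) =
    let _ , β     = card-list es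
        q , γ , _ = card-merge β a b
    in q , card-cong
             (λ { (inj₁ e) → EqC.return (there e) ; (inj₂ refl) → EqC.return (here refl) })
             (λ { (here refl) → EqC.return (inj₂ refl) ; (there e) → EqC.return (inj₁ e) })
             γ

  card-decidable : {R : Rel (Fin N) 0ℓ} → Decidable R → ∃[ p ] Card R p
  card-decidable {R} R? =
    let p , β = card-list (filter (λ (x , y) → R? x y) all-pairs)
    in p , card-cong
             (λ e → EqC.return (proj₂ (∈-filter⁻ _ {xs = all-pairs} e)))
             (λ r → EqC.return (∈-filter⁺ _ (∈-cartesianProduct⁺ (∈-allFin _) (∈-allFin _)) r))
             β
    where all-pairs = cartesianProduct (allFin N) (allFin N)

-- Matchings and flips

private
  variable
    n p q : ℕ

module _ (M : Matching n) where

  partner : Fin (2 * n) → Fin (2 * n)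
  partner i = proj₁ (covered M i)

  pair-partner : ∀ i → Pair M i (partner i)
  pair-partner i = proj₁ (proj₂ (covered M i))

  partner-unique : ∀ {i j} → Pair M i j → partner i ≡ j
  partner-unique {i} = proj₂ (proj₂ (covered M i))

  pair-functional : ∀ {i j k} → Pair M i j → Pair M i k → j ≡ k
  pair-functional ij ik = trans (sym (partner-unique ij)) (partner-unique ik)

  pair-injective : ∀ {i j k} → Pair M i k → Pair M j k → i ≡ j
  pair-injective ik jk = pair-functional (pair-sym M ik) (pair-sym M jk)

  pair? : Decidable (Pair M)
  pair? i j = map′ (λ eq → subst (Pair M i) eq (pair-partner i)) partner-unique (partner i ≟ j)

_≐?_ : Decidable (_≐_ {Fin n})
e ≐? f = (e ≟₂ f) ⊎-dec (e ≟₂ _)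
  where _≟₂_ = Product.≡-dec _≟_ _≟_

⊆⇒≋ : (M M′ : Matching n) → Pair M ⇒ Pair M′ → M ≋ M′
⊆⇒≋ M M′ M⊆M′ i j = mk⇔ M⊆M′ λ ij →
  subst (Pair M i) (pair-functional M′ (M⊆M′ (pair-partner M i)) ij) (pair-partner M i)

-- Component counts of two matchings and the lower bound on distance

π₀-exists : (M M′ : Matching n) → ∃[ p ] Isπ₀ M M′ p
π₀-exists M M′ = card-decidable λ i j → pair? M i j ⊎-dec pair? M′ i j

-- The classes are exactly the pairs of `M`. Listing a representative of each class and its partner
-- gives a bijection from `Fin 2 × Fin p` to the points, so 2p = 2n.
π₀-≋ : (M M′ : Matching n) → M ≋ M′ → Isπ₀ M M′ p → p ≡ n
π₀-≋ {n} {p} M M′ M≋M′ β =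
  ℕ.*-cancelˡ-≡ p n 2 (↔⇒≡ (⤖⇒↔ (mk⤖ (enum-injective , strictlySurjective⇒surjective enum-onto)) ↔-∘ *↔×))
  where
  open Bijection β renaming (cong to cong′)

  -- Being equal or paired is already an equivalence, because the partner of a partner is the
  -- original point.
  ≡∪Pair : IsEquivalence (_≡_ ∪ Pair M)
  ≡∪Pair = record
    { refl  = inj₁ refl
    ; sym   = λ { (inj₁ eq) → inj₁ (sym eq) ; (inj₂ ij) → inj₂ (pair-sym M ij) }
    ; trans = λ { (inj₁ refl) jk        → jk
                ; (inj₂ ij) (inj₁ refl) → inj₂ ij
                ; (inj₂ ij) (inj₂ jk)   → inj₁ (pair-functional M (pair-sym M ij) jk) }
    }

  same-class : ∀ {i j} → to i ≡ to j → i ≡ j ⊎ Pair M i j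
  same-class eq = EqC.fold ≡∪Pair
    [ inj₂ , (λ ij → inj₂ (Equivalence.from (M≋M′ _ _) ij)) ]′ (injective eq)

  rep : Fin p → Fin (2 * n)
  rep k = proj₁ (strictlySurjective k)

  to-rep : ∀ k → to (rep k) ≡ k
  to-rep k = proj₂ (strictlySurjective k)

  to-partner : ∀ i → to (partner M i) ≡ to i
  to-partner i = sym (cong′ (EqC.return (inj₁ (pair-partner M i))))

  enum : Fin 2 × Fin p → Fin (2 * n)
  enum (zero  , k) = rep k
  enum (suc _ , k) = partner M (rep k)

  to-enum : ∀ s k → to (enum (s , k)) ≡ k
  to-enum zero    k = to-rep k
  to-enum (suc _) k = trans (to-partner (rep k)) (to-rep k)

  rep≢partner : ∀ k → rep k ≢ partner M (rep k)
  rep≢partner k eq = pair-irr M eq (pair-partner M (rep k))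

  enum-injective : ∀ {x y} → enum x ≡ enum y → x ≡ y
  enum-injective {s , k} {t , l} eq
    with refl ← trans (sym (to-enum s k)) (trans (cong to eq) (to-enum t l)) = cong (_, k) (sides s t eq)
    where
    sides : ∀ s t → enum (s , k) ≡ enum (t , k) → s ≡ t
    sides zero       zero       _  = refl
    sides zero       (suc zero) eq = contradiction eq (rep≢partner k)
    sides (suc zero) zero       eq = contradiction (sym eq) (rep≢partner k)
    sides (suc zero) (suc zero) _  = refl

  enum-onto : ∀ i → ∃[ x ] enum x ≡ i
  enum-onto i with same-class (to-rep (to i))
  ... | inj₁ eq = (zero , to i) , eq
  ... | inj₂ ri = (suc zero , to i) , partner-unique M ri

-- `M` alone has n components, and adding the pairs of `M′` can only merge them.
π₀≤n : (M M′ : Matching n) → Isπ₀ M M′ p → p ≤ n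
π₀≤n M M′ β with q , γ ← π₀-exists M M =
  subst (_ ≤_) (π₀-≋ M M (λ _ _ → mk⇔ id id) γ)
    (card-mono (λ { (inj₁ ij) → EqC.return (inj₁ ij) ; (inj₂ ij) → EqC.return (inj₁ ij) }) γ β)

-- Once the edge {i , j} is added to the new matching, the two old pairs
-- {i , j} and {k , l} are connected through {j , k} and {i , l}.
π₀-flip : (M M₁ M′ : Matching n) → Flip M M₁ →
          Isπ₀ M M′ p → Isπ₀ M₁ M′ q → q ≤ suc p
π₀-flip M M₁ M′ (i , j , k , l , ij , kl , _ , M₁⇔) β γ
  with r , γ⁺ , q≤1+r ← card-merge γ i j =
  ℕ.≤-trans q≤1+r (s≤s (card-mono reconnect β γ⁺))
  where
  M₁∪M′⁺ = (Pair M₁ ∪ Pair M′) ∪ Edge i j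

  new : ∀ {x y} → (x , y) ≐ (i , l) ⊎ (x , y) ≐ (j , k) → EqClosure M₁∪M′⁺ x y
  new e = EqC.return (inj₁ (inj₁ (Equivalence.from (M₁⇔ _ _) (inj₂ e))))

  i∼j : EqClosure M₁∪M′⁺ i j
  i∼j = EqC.return (inj₂ refl)

  k∼l : EqClosure M₁∪M′⁺ k l
  k∼l = new (inj₂ (inj₂ refl)) ◅◅ EqC.symmetric _ i∼j ◅◅ new (inj₁ (inj₁ refl))

  reconnect : Pair M ∪ Pair M′ ⇒ EqClosure M₁∪M′⁺
  reconnect (inj₂ xy) = EqC.return (inj₁ (inj₂ xy))
  reconnect {x} {y} (inj₁ xy) with (x , y) ≐? (i , j) | (x , y) ≐? (k , l)
  ... | yes (inj₁ refl) | _               = i∼j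
  ... | yes (inj₂ refl) | _               = EqC.symmetric _ i∼j
  ... | no _            | yes (inj₁ refl) = k∼l
  ... | no _            | yes (inj₂ refl) = EqC.symmetric _ k∼l
  ... | no ≢ij          | no ≢kl          =
    EqC.return (inj₁ (inj₁ (Equivalence.from (M₁⇔ x y) (inj₁ (xy , ≢ij , ≢kl)))))

-- Along the walk the count of components shared with `M′` starts at p, ends at n, and rises by at
-- most one per flip.
walk-length : ∀ {k} (M M′ : Matching n) → Walk (Gmat n) k M M′ → Isπ₀ M M′ p → n ≤ k + p
walk-length M M′ (stop M≋M′) β = ℕ.≤-reflexive (sym (π₀-≋ M M′ M≋M′ β))
walk-length {n} {p} {suc k} M M′ (step {y = M₁} M→M₁ walk) β with q , γ ← π₀-exists M₁ M′ =
  begin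
    n           ≤⟨ walk-length M₁ M′ walk γ ⟩
    k + q       ≤⟨ ℕ.+-monoʳ-≤ k (π₀-flip M M₁ M′ M→M₁ β γ) ⟩
    k + suc p   ≡⟨ ℕ.+-suc k p ⟩
    suc k + p   ∎
  where open ℕ.≤-Reasoning

-- This transfers the short noncrossing walk to `Gmat`, and the lower bound for `Gmat` back to
-- `Gncm`.
forget-noncrossing : ∀ {k} {M M′ : Σ (Matching n) NonCrossing} →
                     Walk (Gncm n) k M M′ → Walk (Gmat n) k (proj₁ M) (proj₁ M′)
forget-noncrossing (stop M≋M′)   = stop M≋M′
forget-noncrossing (step e walk) = step e (forget-noncrossing walk)

-- Flips as exchanges of two labels

transpose-i : (i j : Fin n) → Perm.transpose i j ⟨$⟩ʳ i ≡ j
transpose-i i j rewrite dec-true (i ≟ i) refl = refl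

transpose-j : (i j : Fin n) → Perm.transpose i j ⟨$⟩ʳ j ≡ i
transpose-j i j with j ≟ i
... | yes j≡i = j≡i
... | no _ rewrite dec-true (j ≟ j) refl = refl

transpose-fixes : {i j k : Fin n} → k ≢ i → k ≢ j → Perm.transpose i j ⟨$⟩ʳ k ≡ k
transpose-fixes {i = i} {j} {k} k≢i k≢j
  rewrite dec-false (k ≟ i) k≢i | dec-false (k ≟ j) k≢j = refl

-- Pulling back along a permutation preserves the matching laws, so the flipped matching needs no
-- separate proof of them.
relabel : Permutation′ (2 * n) → Matching n → Matching n
relabel π M = record
  { Pair     = λ x y → Pair M (π ⟨$⟩ʳ x) (π ⟨$⟩ʳ y)
  ; pair-irr = λ x≡y → pair-irr M (cong (π ⟨$⟩ʳ_) x≡y)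
  ; pair-sym = pair-sym M
  ; covered  = λ x →
      π ⟨$⟩ˡ partner M (π ⟨$⟩ʳ x) ,
      subst (Pair M _) (sym (Perm.inverseʳ π)) (pair-partner M _) ,
      λ xy → trans (cong (π ⟨$⟩ˡ_) (partner-unique M xy)) (Perm.inverseˡ π)
  }

-- Exchanging the labels a and j turns the pairs {i , a} and {b , j} into
-- {i , j} and {a , b}.

module Exchange (M : Matching n) {i a b j : Fin (2 * n)}
  (ia : Pair M i a) (bj : Pair M b j) (i≢j : i ≢ j) (a≢j : a ≢ j) where

  exchanged : Matching n
  exchanged = relabel (Perm.transpose a j) M

  private
    τ : Fin (2 * n) → Fin (2 * n)
    τ = Perm.transpose a j ⟨$⟩ʳ_

    i≢a : i ≢ a
    i≢a eq = pair-irr M eq ia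

    b≢j : b ≢ j
    b≢j eq = pair-irr M eq bj

    b≢a : b ≢ a
    b≢a refl = i≢j (pair-functional M (pair-sym M ia) bj)

    τi≡i : τ i ≡ i
    τi≡i = transpose-fixes i≢a i≢j

    τb≡b : τ b ≡ b
    τb≡b = transpose-fixes b≢a b≢j

  pair-ij : Pair exchanged i j
  pair-ij rewrite τi≡i | transpose-j a j = ia

  pair-ab : Pair exchanged a b
  pair-ab rewrite τb≡b | transpose-i a j = pair-sym M bj

  -- The first alternative in the definition of `Flip`, when {i, a} and {b, j} are the pairs
  -- removed.
  Kept : Rel (Fin (2 * n)) 0ℓ
  Kept x y = Pair M x y × ¬ ((x , y) ≐ (i , a)) × ¬ ((x , y) ≐ (b , j))

  kept-sym : ∀ {x y} → Kept x y → Kept y x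
  kept-sym (xy , ≢ia , ≢bj) =
    pair-sym M xy ,
    (λ { (inj₁ refl) → ≢ia (inj₂ refl) ; (inj₂ refl) → ≢ia (inj₁ refl) }) ,
    (λ { (inj₁ refl) → ≢bj (inj₂ refl) ; (inj₂ refl) → ≢bj (inj₁ refl) })

  kept-≢i : ∀ {x y} → Kept x y → x ≢ i
  kept-≢i (xy , ≢ia , _) refl = ≢ia (inj₁ (cong (i ,_) (pair-functional M xy ia)))

  kept-≢a : ∀ {x y} → Kept x y → x ≢ a
  kept-≢a (xy , ≢ia , _) refl = ≢ia (inj₂ (cong (a ,_) (pair-functional M xy (pair-sym M ia))))

  kept-≢j : ∀ {x y} → Kept x y → x ≢ j
  kept-≢j (xy , _ , ≢bj) refl = ≢bj (inj₂ (cong (j ,_) (pair-functional M xy (pair-sym M bj))))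

  -- The transposition moves only `a` and `j`. A pair avoiding both is an old one, and a pair
  -- meeting either is determined by uniqueness of partners.
  exchanged-pairs : ∀ x y → Pair exchanged x y →
                    Kept x y ⊎ (x , y) ≐ (i , j) ⊎ (x , y) ≐ (a , b)
  exchanged-pairs x y xy = cases xy (x ≟ a) (x ≟ j) (y ≟ a) (y ≟ j)
    where
    cases : ∀ {x y} → Pair exchanged x y →
            Dec (x ≡ a) → Dec (x ≡ j) → Dec (y ≡ a) → Dec (y ≡ j) →
            Kept x y ⊎ (x , y) ≐ (i , j) ⊎ (x , y) ≐ (a , b)
    cases {y = y} xy (yes refl) _ _ _ =
      inj₂ (inj₂ (inj₁ (cong (a ,_) (pair-functional exchanged {a} {y} {b} xy pair-ab))))
    cases {y = y} xy (no _) (yes refl) _ _ =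
      inj₂ (inj₁ (inj₂ (cong (j ,_) (pair-functional exchanged {j} {y} {i} xy (pair-sym M pair-ij)))))
    cases {x} xy (no _) (no _) (yes refl) _ =
      inj₂ (inj₂ (inj₂ (cong (_, a) (pair-injective exchanged {x} {b} {a} xy (pair-sym M pair-ab)))))
    cases {x} xy (no _) (no _) (no _) (yes refl) =
      inj₂ (inj₁ (inj₁ (cong (_, j) (pair-injective exchanged {x} {i} {j} xy pair-ij))))
    cases xy (no x≢a) (no x≢j) (no y≢a) (no y≢j)
      rewrite transpose-fixes x≢a x≢j | transpose-fixes y≢a y≢j =
      inj₁ (xy , (λ { (inj₁ refl) → y≢a refl ; (inj₂ refl) → x≢a refl })
               , (λ { (inj₁ refl) → y≢j refl ; (inj₂ refl) → x≢j refl }))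

  kept-exchanged : ∀ {x y} → Kept x y → Pair exchanged x y
  kept-exchanged {x} {y} k
    rewrite transpose-fixes (kept-≢a k) (kept-≢j k)
          | transpose-fixes (kept-≢a (kept-sym k)) (kept-≢j (kept-sym k)) = proj₁ k

  exchanged-flip : Flip M exchanged
  exchanged-flip = i , a , b , j , ia , bj , ≢ , λ x y → mk⇔ (exchanged-pairs x y)
    [ kept-exchanged , [ (λ { (inj₁ refl) → pair-ij ; (inj₂ refl) → pair-sym M pair-ij })
                       , (λ { (inj₁ refl) → pair-ab ; (inj₂ refl) → pair-sym M pair-ab }) ]′ ]′
    where
    ≢ : ¬ ((i , a) ≐ (b , j))
    ≢ (inj₁ refl) = a≢j refl
    ≢ (inj₂ refl) = i≢j refl

-- A noncrossing flip that creates a new component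

-- A partner `v` outside the interval would make the two pairs cross, and `v` cannot be an endpoint
-- because partners are unique.
nested : (M : Matching n) → NonCrossing M → ∀ {x z u v} →
         Pair M x z → Pair M u v → x < u → u < z → x < v × v < z
nested M nc {x} {z} {u} {v} xz uv x<u u<z = x<v , v<z
  where
  x<v : x < v
  x<v with Fin.<-cmp x v
  ... | tri< x<v _ _  = x<v
  ... | tri≈ _ refl _ = contradiction u<z (Fin.<-irrefl (pair-functional M (pair-sym M uv) xz))
  ... | tri> _ _ v<x  = contradiction (v , x , u , z , v<x , x<u , u<z , pair-sym M uv , xz) nc

  v<z : v < z
  v<z with Fin.<-cmp v z
  ... | tri< v<z _ _  = v<z
  ... | tri≈ _ refl _ = contradiction x<u (Fin.<-irrefl (pair-injective M xz uv))
  ... | tri> _ _ z<v  = contradiction (x , u , z , v , x<u , u<z , z<v , xz , uv) nc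

least : {P : Fin n → Set} → U.Decidable P → ∃ P → ∃[ m ] P m × (∀ k → k < m → ¬ P k)
least {n} {P} P? (x , Px) with ¬∀⟶∃¬-smallest n (¬_ ∘ P) (λ k → ¬? (P? k)) (λ ∀¬P → ∀¬P x Px)
... | m , ¬¬Pm , below = m , decidable-stable (P? m) ¬¬Pm , λ k k<m →
  subst (¬_ ∘ P) (toℕ-injective (trans (toℕ-inject (fromℕ< k<m)) (toℕ-fromℕ< k<m)))
    (below (fromℕ< k<m))

module _ (M M′ : Matching n) (nc′ : NonCrossing M′) where

  -- The field inside is what remains of: all pairs of M′ inside {i , j} are in M.

  record Pivot : Set where
    field
      {i j}    : Fin (2 * n)
      i<j      : i < j
      pair′    : Pair M′ i j
      not-pair : ¬ Pair M i j
      inside   : ∀ {x y} → i < x → x < j → Pair M x y → i < y × y < j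

  -- The larger endpoint comes first because the pivot is chosen by minimizing it.
  New : Rel (Fin (2 * n)) 0ℓ
  New j i = i < j × ¬ Pair M i j

  New? : U.Decidable λ j → New j (partner M′ j)
  New? j = (partner M′ j <? j) ×-dec ¬? (pair? M (partner M′ j) j)

  -- If every pair of `M′` is in `M`, the matchings agree. Otherwise the missing pair with the least
  -- larger endpoint `j` is a pivot.
  pivot-or-≋ : Pivot ⊎ M ≋ M′
  pivot-or-≋ with any? New?
  ... | no none = inj₂ λ i j → let e = ⊆⇒≋ M′ M M′⊆M i j in mk⇔ (Equivalence.from e) (Equivalence.to e)
    where
    descending : ∀ {i j} → i < j → Pair M′ i j → Pair M i j
    descending {i} {j} i<j ij with refl ← partner-unique M′ (pair-sym M′ ij) =
      decidable-stable (pair? M i j) λ ¬ij → none (j , i<j , ¬ij)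

    M′⊆M : Pair M′ ⇒ Pair M
    M′⊆M {i} {j} ij with Fin.<-cmp i j
    ... | tri< i<j _ _ = descending i<j ij
    ... | tri≈ _ i≡j _ = contradiction ij (pair-irr M′ i≡j)
    ... | tri> _ _ j<i = pair-sym M (descending j<i (pair-sym M′ ij))
  ... | yes some with j , (i<j , ¬ij) , below ← least New? some = inj₁ record
    { i<j = i<j ; pair′ = ij ; not-pair = ¬ij ; inside = inside }
    where
    i = partner M′ j

    ij : Pair M′ i j
    ij = pair-sym M′ (pair-partner M′ j)

    old : ∀ {x y} → y < j → Pair M′ x y → x < y → Pair M x y
    old {x} {y} y<j xy x<y with refl ← partner-unique M′ (pair-sym M′ xy) =
      decidable-stable (pair? M x y) λ ¬xy → below y y<j (x<y , ¬xy)

    -- Since `M′` is noncrossing, the `M′`-partner of `x` also lies between `i` and `j`. That pair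
    -- ends before `j`, so it is in `M` by minimality, and the partner is `y`.
    inside : ∀ {x y} → i < x → x < j → Pair M x y → i < y × y < j
    inside {x} {y} i<x x<j xy = subst (λ y → i < y × y < j) x′≡y (i<x′ , x′<j)
      where
      x′ = partner M′ x

      xx′ : Pair M′ x x′
      xx′ = pair-partner M′ x

      i<x′ : i < x′
      i<x′ = proj₁ (nested M′ nc′ ij xx′ i<x x<j)

      x′<j : x′ < j
      x′<j = proj₂ (nested M′ nc′ ij xx′ i<x x<j)

      x′≡y : x′ ≡ y
      x′≡y with Fin.<-cmp x x′
      ... | tri< x<x′ _ _ = pair-functional M (old x′<j xx′ x<x′) xy
      ... | tri≈ _ x≡x′ _ = contradiction xx′ (pair-irr M′ x≡x′)
      ... | tri> _ _ x′<x = pair-functional M (pair-sym M (old x<j (pair-sym M′ xx′) x′<x)) xy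

module Improve (M M′ : Matching n) (nc : NonCrossing M) (nc′ : NonCrossing M′)
  (pivot : Pivot M M′ nc′) where

  open Pivot pivot

  private
    a b : Fin (2 * n)
    a = partner M i
    b = partner M j

    ia : Pair M i a
    ia = pair-partner M i

    jb : Pair M j b
    jb = pair-partner M j

  open Exchange M ia (pair-sym M jb) (Fin.<⇒≢ i<j)
    (λ a≡j → not-pair (subst (Pair M i) a≡j ia)) public

  private
    -- If `v` were strictly between `i` and `j`, its partner `u` would be too; and `v` is not `j`,
    -- whose pair was removed. `around′` is the mirror image.
    around : ∀ {u v} → Kept u v → u < i → i < v → j < v
    around {u} {v} uv u<i i<v with Fin.<-cmp v j
    ... | tri< v<j _ _ = contradiction u<i (ℕ.<-asym (proj₁ (inside i<v v<j (pair-sym M (proj₁ uv)))))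
    ... | tri≈ _ v≡j _ = contradiction v≡j (kept-≢j (kept-sym uv))
    ... | tri> _ _ j<v = j<v

    around′ : ∀ {u v} → Kept u v → u < j → j < v → u < i
    around′ {u} {v} uv u<j j<v with Fin.<-cmp u i
    ... | tri< u<i _ _ = u<i
    ... | tri≈ _ u≡i _ = contradiction u≡i (kept-≢i uv)
    ... | tri> _ _ i<u = contradiction j<v (ℕ.<-asym (proj₂ (inside i<u u<j (proj₁ uv))))

    -- A kept pair enclosing a encloses i, hence j, hence b, and conversely.
    a-to-b : ∀ {u v} → Kept u v → u < a → a < v → u < b × b < v
    a-to-b uv u<a a<v =
      let u<i , i<v = nested M nc (proj₁ uv) (pair-sym M ia) u<a a<v
      in nested M nc (proj₁ uv) jb (ℕ.<-trans u<i i<j) (around uv u<i i<v)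

    b-to-a : ∀ {u v} → Kept u v → u < b → b < v → u < a × a < v
    b-to-a uv u<b b<v =
      let u<j , j<v = nested M nc (proj₁ uv) (pair-sym M jb) u<b b<v
      in nested M nc (proj₁ uv) ia (around′ uv u<j j<v) (ℕ.<-trans i<j j<v)

    ab-nested : ∀ {u v x y} → Kept u v → (x , y) ≐ (a , b) → u < x → x < v → u < y × y < v
    ab-nested uv (inj₁ refl) = a-to-b uv
    ab-nested uv (inj₂ refl) = b-to-a uv

    -- The pivot interval stays closed under partners: neither `a` nor `b` lies strictly inside it,
    -- since then its old partner `i` or `j` would as well.
    inside′ : ∀ {x y} → i < x → x < j → Pair exchanged x y → i < y × y < j
    inside′ {x} {y} i<x x<j xy with exchanged-pairs x y xy
    ... | inj₁ (xy , _)             = inside i<x x<j xy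
    ... | inj₂ (inj₁ (inj₁ refl)) = contradiction i<x (Fin.<-irrefl refl)
    ... | inj₂ (inj₁ (inj₂ refl)) = contradiction x<j (Fin.<-irrefl refl)
    ... | inj₂ (inj₂ (inj₁ refl)) =
      contradiction (proj₁ (inside i<x x<j (pair-sym M ia))) (Fin.<-irrefl refl)
    ... | inj₂ (inj₂ (inj₂ refl)) =
      contradiction (proj₂ (inside i<x x<j (pair-sym M jb))) (Fin.<-irrefl refl)

  -- `inside′` excludes crossings with {i, j}, `ab-nested` those of a kept pair with {a, b}, and
  -- `nc` those of two kept pairs. The remaining cases use {a, b} twice and contradict the order of
  -- the points.
  exchanged-noncrossing : NonCrossing exchanged
  exchanged-noncrossing (w , x , y , z , w<x , x<y , y<z , wy , xz)
    with exchanged-pairs w y wy | exchanged-pairs x z xz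
  ... | inj₂ (inj₁ (inj₁ refl)) | _ = ℕ.<-asym y<z (proj₂ (inside′ w<x x<y xz))
  ... | inj₂ (inj₁ (inj₂ refl)) | _ = ℕ.<-asym i<j (ℕ.<-trans w<x x<y)
  ... | _ | inj₂ (inj₁ (inj₁ refl)) =
    ℕ.<-asym w<x (proj₁ (inside′ x<y y<z (pair-sym exchanged {w} {y} wy)))
  ... | _ | inj₂ (inj₁ (inj₂ refl)) = ℕ.<-asym i<j (ℕ.<-trans x<y y<z)
  ... | inj₁ wy′ | inj₁ xz′ =
    nc (w , x , y , z , w<x , x<y , y<z , proj₁ wy′ , proj₁ xz′)
  ... | inj₁ wy′ | inj₂ (inj₂ xz≐ab) = ℕ.<-asym y<z (proj₂ (ab-nested wy′ xz≐ab w<x x<y))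
  ... | inj₂ (inj₂ wy≐ab) | inj₁ xz′ = ℕ.<-asym w<x (proj₁ (ab-nested xz′ (≐-swap wy≐ab) x<y y<z))
    where
    ≐-swap : ∀ {x y} → (x , y) ≐ (a , b) → (y , x) ≐ (a , b)
    ≐-swap (inj₁ refl) = inj₂ refl
    ≐-swap (inj₂ refl) = inj₁ refl
  ... | inj₂ (inj₂ (inj₁ refl)) | inj₂ (inj₂ (inj₁ refl)) = Fin.<-irrefl refl w<x
  ... | inj₂ (inj₂ (inj₁ refl)) | inj₂ (inj₂ (inj₂ refl)) = Fin.<-irrefl refl x<y
  ... | inj₂ (inj₂ (inj₂ refl)) | inj₂ (inj₂ (inj₁ refl)) = Fin.<-irrefl refl x<y
  ... | inj₂ (inj₂ (inj₂ refl)) | inj₂ (inj₂ (inj₂ refl)) = Fin.<-irrefl refl w<x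

  private
    U : Rel (Fin (2 * n)) 0ℓ
    U = Pair exchanged ∪ Pair M′

    -- {i, j} is a pair of both `exchanged` and `M′`, so it is a full component.
    U-ij-closed : ∀ {x y} → U x y → (x ≡ i ⊎ x ≡ j) → (y ≡ i ⊎ y ≡ j)
    U-ij-closed {y = y} (inj₁ xy) (inj₁ refl) = inj₂ (pair-functional exchanged {i} {y} {j} xy pair-ij)
    U-ij-closed {y = y} (inj₁ xy) (inj₂ refl) =
      inj₁ (pair-functional exchanged {j} {y} {i} xy (pair-sym exchanged {i} {j} pair-ij))
    U-ij-closed (inj₂ xy) (inj₁ refl) = inj₂ (pair-functional M′ xy pair′)
    U-ij-closed (inj₂ xy) (inj₂ refl) = inj₁ (pair-functional M′ xy (pair-sym M′ pair′))

    U-sym : ∀ {x y} → U x y → U y x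
    U-sym {x} {y} (inj₁ xy) = inj₁ (pair-sym exchanged {x} {y} xy)
    U-sym         (inj₂ xy) = inj₂ (pair-sym M′ xy)

    i≁a : ¬ EqClosure U i a
    i≁a i∼a with Equivalence.to i∼a-closed (inj₁ refl)
      where
      i∼a-closed : (i ≡ i ⊎ i ≡ j) ⇔ (a ≡ i ⊎ a ≡ j)
      -- Membership in {i, j} is invariant along the generated relation, yet it holds at `i` and
      -- fails at `a`.
      i∼a-closed = EqC.gfold ⇔-isEquivalence (λ x → x ≡ i ⊎ x ≡ j)
        (λ xy → mk⇔ (U-ij-closed xy) (U-ij-closed (U-sym xy))) i∼a
    ... | inj₁ a≡i = pair-irr M (sym a≡i) ia
    ... | inj₂ a≡j = not-pair (subst (Pair M i) a≡j ia)

    split : U ∪ Edge i a ⇒ EqClosure (Pair M ∪ Pair M′)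
    split (inj₂ refl)      = EqC.return (inj₁ ia)
    split (inj₁ (inj₂ xy)) = EqC.return (inj₂ xy)
    split {x} {y} (inj₁ (inj₁ xy)) with exchanged-pairs x y xy
    ... | inj₁ (xy , _)           = EqC.return (inj₁ xy)
    ... | inj₂ (inj₁ (inj₁ refl)) = EqC.return (inj₂ pair′)
    ... | inj₂ (inj₁ (inj₂ refl)) = EqC.return (inj₂ (pair-sym M′ pair′))
    ... | inj₂ (inj₂ xy≐ab)       = [ (λ { refl → a∼b }) , (λ { refl → EqC.symmetric _ a∼b }) ]′ xy≐ab
      where
      a∼b : EqClosure (Pair M ∪ Pair M′) a b
      -- The path is a, i, j, b, through pairs of `M`, `M′` and `M`.
      a∼b = EqC.return (inj₁ (pair-sym M ia)) ◅◅ EqC.return (inj₂ pair′) ◅◅ EqC.return (inj₁ jb)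

    rejoin : Pair M ∪ Pair M′ ⇒ EqClosure (U ∪ Edge i a)
    rejoin (inj₂ xy) = EqC.return (inj₁ (inj₂ xy))
    rejoin {x} {y} (inj₁ xy) with (x , y) ≐? (i , a) | (x , y) ≐? (b , j)
    ... | yes (inj₁ refl) | _ = EqC.return (inj₂ refl)
    ... | yes (inj₂ refl) | _ = EqC.symmetric _ (EqC.return (inj₂ refl))
    ... | no ≢ia | no ≢bj     = EqC.return (inj₁ (inj₁ (kept-exchanged (xy , ≢ia , ≢bj))))
    ... | no _   | yes xy≐bj  = [ (λ { refl → b∼j }) , (λ { refl → EqC.symmetric _ b∼j }) ]′ xy≐bj
      where
      b∼j : EqClosure (U ∪ Edge i a) b j
      -- The path is b, a, i, j: the new pair {a, b}, the added edge, and the pair {i, j} of `M′`.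
      b∼j = EqC.symmetric _ (EqC.return (inj₁ (inj₁ pair-ab)))
         ◅◅ EqC.symmetric _ (EqC.return (inj₂ refl))
         ◅◅ EqC.return (inj₁ (inj₂ pair′))

  -- Adding the edge {i, a} merges two distinct components of `U` and restores the components of `M`
  -- and `M′`, so the flip gained exactly one.
  π₀-exchanged : Isπ₀ M M′ p → Isπ₀ exchanged M′ (suc p)
  π₀-exchanged β with q , γ ← π₀-exists exchanged M′
                 with r , refl , δ ← card-merge-unrelated γ i≁a
                 with refl ← HasCardinality-unique β (card-cong split rejoin δ) = γ

-- The upper bound and the distance formula

noncrossing-walk : ∀ d (M M′ : Matching n) (nc : NonCrossing M) (nc′ : NonCrossing M′) →
                   Isπ₀ M M′ p → d + p ≡ n → Walk (Gncm n) d (M , nc) (M′ , nc′)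
noncrossing-walk {n} {p} d M M′ nc nc′ β d+p≡n with pivot-or-≋ M M′ nc′
... | inj₂ M≋M′ with refl ← π₀-≋ M M′ M≋M′ β
                with refl ← ℕ.+-cancelʳ-≡ n d 0 d+p≡n = stop M≋M′
-- Here p = n, so the exchange would produce n + 1 components, which exceeds the bound.
noncrossing-walk zero M M′ nc nc′ β refl | inj₁ pivot =
  contradiction (π₀≤n exchanged M′ (π₀-exchanged β)) ℕ.1+n≰n
  where open Improve M M′ nc nc′ pivot
noncrossing-walk {p = p} (suc d) M M′ nc nc′ β d+p≡n | inj₁ pivot =
  -- The flip raises the count by one while the remaining length falls by one, so their sum stays n.
  step exchanged-flip
    (noncrossing-walk d exchanged M′ exchanged-noncrossing nc′ (π₀-exchanged β)
      (trans (ℕ.+-suc d p) d+p≡n))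
  where open Improve M M′ nc nc′ pivot

theorem5p7 : (n : ℕ) → n ≥ 1 → (M M′ : Matching n) (nc : NonCrossing M) (nc′ : NonCrossing M′) →
    ∃[ p ] ∃[ d ] ∃[ e ]
    (Isπ₀ M M′ p
    × IsDistance (Gncm n) (M , nc) (M′ , nc′) d
    × IsDistance (Gmat n) M M′ e
    × d ≡ e
    × + e ≡ + n - + p)
theorem5p7 n _ M M′ nc nc′ with p , β ← π₀-exists M M′ =
  -- Both distances are given by truncated subtraction, which agrees with the integer difference
  -- because p ≤ n.
  p , n ∸ p , n ∸ p , β ,
  (walk , λ k w → minimal k (forget-noncrossing w)) ,
  (forget-noncrossing walk , minimal) ,
  refl ,
  sym (trans (ℤ.m-n≡m⊖n n p) (ℤ.⊖-≥ p≤n))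
  where
  p≤n : p ≤ n
  p≤n = π₀≤n M M′ β

  walk : Walk (Gncm n) (n ∸ p) (M , nc) (M′ , nc′)
  walk = noncrossing-walk (n ∸ p) M M′ nc nc′ β (ℕ.m∸n+n≡m p≤n)

  minimal : ∀ k → Walk (Gmat n) k M M′ → n ∸ p ≤ k
  minimal k w = ℕ.m≤n+o⇒m∸n≤o n p (subst (n ≤_) (ℕ.+-comm k p) (walk-length M M′ w β))
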